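{- Let $\kappa$ be an uncountable cardinal with $\kappa=\kappa^{<\kappa}$. Assume that $\kappa$ is not weakly compact and that all closed subsets of ${}^\kappa\kappa$ have the $\kappa$-perfect set property. Then for every $A\subseteq{}^\kappa\kappa$ the following are equivalent: (a) $A$ is a $\mathrm{K}_\kappa$ subset of ${}^\kappa\kappa$; (b) $A$ is contained in a $\mathrm{K}_\kappa$ subset of ${}^\kappa\kappa$; (c) $A$ has cardinality at most $\kappa$.
   Context: ${}^\kappa\kappa$ is the set of all functions from $\kappa$ to $\kappa$ with the bounded topology, whose basic open sets are $N_s=\{x\in{}^\kappa\kappa \mid s\subseteq x\}$ for $s\in{}^{<\kappa}\kappa$ (functions from an ordinal ${<}\kappa$ into $\kappa$); ${}^\kappa 2$ carries the subspace topology. $A\subseteq{}^\kappa\kappa$ is $\kappa$-compact if every open cover of $A$ has a subcover of size less than $\kappa$, and $\mathrm{K}_\kappa$ if it is a union of $\kappa$-many (i.e. at most $\kappa$-many) $\kappa$-compact subsets of ${}^\kappa\kappa$. $A$ has the $\kappa$-perfect set property if either $A$ has cardinality at most $\kappa$, or else $A$ contains a closed subset of ${}^\kappa\kappa$ homeomorphic to ${}^\kappa 2$. -}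

module Defs where

open import Data.Bool.Base using (Bool)
open import Data.Nat.Base using (ℕ)
open import Data.Product.Base using (Σ; Σ-syntax; ∃-syntax; _×_; proj₂)
open import Data.Refinement.Base using (Refinement-syntax; value)
open import Data.Sum.Base using (_⊎_)
open import Function.Bundles using (_↔_; _↣_; Inverse)
open import Induction.WellFounded using (WellFounded)
open import Level using (Level; 0ℓ; _⊔_) renaming (suc to lsuc)
open import Relation.Binary.Core using (Rel)
open import Relation.Binary.PropositionalEquality.Core using (_≡_)
open import Relation.Binary.Structures using (IsStrictTotalOrder)
open import Relation.Nullary.Negation.Core using (¬_)
open import Relation.Unary using (Pred; _⊆_; _≐_; ⋃; ∁; _⊢_; _∈_)

-- The results are about classical set theory. Nothing below depends on
-- classical axioms or on function extensionality, but the notions have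
-- their usual meaning only in their presence. Sets are types in `Set`,
-- subsets are predicates, and a subset A of X is regarded as a set in its
-- own right through the refinement type [ x ∈ X ∣ A x ], whose elements
-- are equal as soon as their values are.

Subset : Set → Set₁
Subset X = Pred X 0ℓ

-- A cardinal is an initial ordinal: a well-order that does not inject into
-- any of its proper initial segments. An element α stands for the ordinal
-- α < κ, and Seg α for the set of its predecessors, which is α itself in
-- von Neumann's presentation.

record Cardinal : Set₁ where
  field
    Carrier            : Set
    _<_                : Rel Carrier 0ℓ
    isStrictTotalOrder : IsStrictTotalOrder _≡_ _<_
    wellFounded        : WellFounded _<_

  Seg : Carrier → Set
  Seg α = [ β ∈ Carrier ∣ β < α ]

  field
    initial : ∀ α → ¬ (Carrier ↣ Seg α)

open Cardinal using (Carrier; Seg)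

module _ (κ : Cardinal) where

  open Cardinal κ using (_<_)

  Uncountable : Set
  Uncountable = ¬ (Carrier κ ↣ ℕ)

  Size≤ : {X : Set} → Subset X → Set
  Size≤ {X} A = [ x ∈ X ∣ A x ] ↣ Carrier κ

  Size≡ : {X : Set} → Subset X → Set
  Size≡ {X} A = [ x ∈ X ∣ A x ] ↔ Carrier κ

  Size< : {X : Set} → Subset X → Set
  Size< {X} A = ∃[ α ] ([ x ∈ X ∣ A x ] ↣ Seg κ α)

  -- The sequences of length < κ with entries in B; the first component of
  -- a sequence is its length.
  Seq< : Set → Set
  Seq< B = Σ[ α ∈ Carrier κ ] (Seg κ α → B)

  -- κ = κ^{<κ}
  PowerStable : Set
  PowerStable = Carrier κ ↔ Seq< (Carrier κ)

  -- κ → (κ)²₂ for uncountable κ. The set [κ]² of unordered pairs is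
  -- identified with the increasing pairs, so only the values c α β with
  -- α < β matter.
  WeaklyCompact : Set₁
  WeaklyCompact = Uncountable ×
    ((c : Carrier κ → Carrier κ → Bool) →
      Σ[ H ∈ Subset (Carrier κ) ] Size≡ H ×
        (∃[ i ] (∀ {α β} → α ∈ H → β ∈ H → α < β → c α β ≡ i)))

Topology : Set → (ℓ : Level) → Set (lsuc 0ℓ ⊔ lsuc ℓ)
Topology X ℓ = Pred (Subset X) ℓ

subspace : {X : Set} {ℓ : Level} → Topology X ℓ → (A : Subset X) →
           Topology [ x ∈ X ∣ A x ] (lsuc 0ℓ ⊔ ℓ)
subspace {X} τ A V = Σ[ U ∈ Subset X ] τ U × V ≐ (value ⊢ U)

Continuous : {X Y : Set} {ℓ ℓ′ : Level} →
             Topology X ℓ → Topology Y ℓ′ → (X → Y) → Set (lsuc 0ℓ ⊔ ℓ ⊔ ℓ′)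
Continuous {Y = Y} τ σ f = (V : Subset Y) → σ V → τ (f ⊢ V)

Homeomorphic : {X Y : Set} {ℓ ℓ′ : Level} →
               Topology X ℓ → Topology Y ℓ′ → Set (lsuc 0ℓ ⊔ ℓ ⊔ ℓ′)
Homeomorphic {X} {Y} τ σ =
  Σ[ f ∈ X ↔ Y ] Continuous τ σ (Inverse.to f) × Continuous σ τ (Inverse.from f)

module _ (κ : Cardinal) where

  -- The functions from κ to B. The generalized Baire space is
  -- Fun κ (Carrier κ). The generalized Cantor space is Fun κ Bool: its
  -- bounded topology is the one it inherits when Bool is identified with
  -- the subset {0, 1} of κ.
  Fun : Set → Set
  Fun B = Carrier κ → B

  Baire : Set
  Baire = Fun (Carrier κ)

  Cone : {B : Set} → Seq< κ B → Subset (Fun B)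
  Cone s x = ∀ β → x (value β) ≡ proj₂ s β

  bounded : (B : Set) → Topology (Fun B) 0ℓ
  bounded B U = ∀ x → x ∈ U → Σ[ s ∈ Seq< κ B ] x ∈ Cone s × Cone s ⊆ U

  Open : Subset Baire → Set
  Open = bounded (Carrier κ)

  Closed : Subset Baire → Set
  Closed C = Open (∁ C)

  -- Covers are indexed families of open sets, and a subcover is given by a
  -- subset J of the index set.
  Compact : Subset Baire → Set₁
  Compact A = (I : Set) (U : I → Subset Baire) →
    (∀ i → Open (U i)) → A ⊆ ⋃[ i ∶ I ] U i →
    Σ[ J ∈ Subset I ] Size< κ J × (∀ {x} → x ∈ A → ∃[ i ] i ∈ J × x ∈ U i)

  IsKκ : Subset Baire → Set₁
  IsKκ A = Σ[ I ∈ Set ] Σ[ C ∈ (I → Subset Baire) ]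
    (I ↣ Carrier κ) × (∀ i → Compact (C i)) × A ≐ ⋃[ i ∶ I ] C i

  PerfectSetProperty : Subset Baire → Set₁
  PerfectSetProperty A = Size≤ κ A ⊎
    (Σ[ C ∈ Subset Baire ] C ⊆ A × Closed C ×
      Homeomorphic (subspace (bounded (Carrier κ)) C) (bounded Bool))

{-# OPTIONS --safe #-}

-- If κ-compact sets have size at most κ, then so do Kκ sets, because κ · κ = κ;
-- conversely, singletons are κ-compact. Now κ = κ^{<κ} makes κ regular, by
-- diagonalisation, so κ-compact sets are closed, and by the perfect set property
-- a κ-compact set of size greater than κ would contain a closed copy of ^κ2,
-- making ^κ2 κ-compact. That implies κ → (κ)²₂: given a colouring c, if no x in
-- ^κ2 satisfied
--   for all γ there is β ≥ γ with c(α, β) = x(α) for all α < γ,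
-- then the open sets U_γ of those x that fail this at γ would increase to ^κ2, so
-- U_γ = ^κ2 for some γ; but c(·, γ) is not in U_γ. From such an x a homogeneous
-- set is built by recursion.
module Submission where

open import Defs
open import Axiom.ExcludedMiddle using (ExcludedMiddle)
open import Axiom.Extensionality.Propositional using (Extensionality)
open import Axiom.UniquenessOfIdentityProofs using (module Decidable⇒UIP)
open import Data.Bool.Base using (Bool; true; false)
open import Data.Bool.Properties using (¬-not)
open import Data.Irrelevant using ([_])
open import Data.Maybe.Base using (Maybe; just; nothing; maybe)
open import Data.Maybe.Properties using (just-injective)
open import Data.Nat.Base using (ℕ)
open import Data.Product.Base
  using (Σ-syntax; ∃-syntax; _×_; _,_; proj₁; proj₂)
open import Data.Product.Properties using (,-injectiveʳ-UIP)
open import Data.Refinement.Base using (Refinement; _,_; value)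
open import Data.Refinement.Properties using (value-injective)
open import Data.Sum.Base using ([_,_]′)
open import Function.Base using (_∘_)
open import Function.Bundles
  using (_⇔_; _↣_; Injection; Inverse; mk↣; mk⇔; mk↔ₛ′)
open import Function.Construct.Composition using (_↣-∘_)
open import Function.Properties.Inverse using (↔⇒↣; ↔-sym)
open import Induction.WellFounded using (module All; module FixPoint)
open import Level using (0ℓ; suc; lift; lower; Lift)
open import Relation.Binary.Definitions using (tri<; tri≈; tri>)
open import Relation.Binary.PropositionalEquality
  using (_≡_; _≢_; refl; sym; trans; cong; subst)
open import Relation.Binary.Structures using (module IsStrictTotalOrder)
open import Relation.Nullary.Decidable
  using (yes; no; map′; decidable-stable; recompute)
open import Relation.Nullary.Negation.Core using (¬_; contradiction)
open import Relation.Unary using (_⊆_; ⋃; ∁; _∈_)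

open Cardinal using (Carrier; Seg)

-- Excluded middle decides types rather than truncated propositions, so dne
-- produces witnesses and gives the axiom of choice.
module Choice (em : ExcludedMiddle (suc 0ℓ)) where

  lem : ExcludedMiddle 0ℓ
  lem = map′ lower lift (em {Lift _ _})

  dne : {P : Set} → ¬ ¬ P → P
  dne = decidable-stable lem

  ¬∀⇒∃¬ : {X : Set} {P : X → Set} → ¬ (∀ x → P x) → ∃[ x ] ¬ P x
  ¬∀⇒∃¬ ¬∀ = dne λ ¬∃ → ¬∀ λ x → dne λ ¬p → ¬∃ (x , ¬p)

  -- The proof stored in a refinement is irrelevant; `recompute` restores a usable one because every
  -- type is decided by `lem`.
  holds : {X : Set} {P : X → Set} (v : Refinement X P) → P (value v)
  holds (_ , [ p ]) = recompute lem p

module Stable (em : ExcludedMiddle (suc 0ℓ)) (ext : Extensionality 0ℓ 0ℓ)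
              (κ : Cardinal) (unc : Uncountable κ) (stable : PowerStable κ) where

  open Choice em
  open Cardinal κ using (_<_; wellFounded; initial)
  open IsStrictTotalOrder (Cardinal.isStrictTotalOrder κ)
    using (compare; irrefl; asym; _≟_) renaming (trans to <-trans)

  private
    K = Carrier κ

  -- The order of κ

  -- By totality, `¬ (γ < β)` stands for β ≤ γ, here and below.
  <-≮-trans : ∀ {α β γ} → α < β → ¬ (γ < β) → α < γ
  <-≮-trans {α} {β} {γ} α<β γ≮β with compare β γ
  ... | tri< β<γ _ _ = <-trans α<β β<γ
  ... | tri≈ _ refl _ = α<β
  ... | tri> _ _ γ<β = contradiction γ<β γ≮β

  <-≢⇒> : ∀ {α β} → ¬ (α < β) → α ≢ β → β < α
  <-≢⇒> {α} {β} α≮β α≢β with compare α β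
  ... | tri< α<β _ _ = contradiction α<β α≮β
  ... | tri≈ _ α≡β _ = contradiction α≡β α≢β
  ... | tri> _ _ β<α = β<α

  module _ {h : K → K} (mono : ∀ {α β} → α < β → h α < h β) where

    mono⇒injective : ∀ {α β} → h α ≡ h β → α ≡ β
    mono⇒injective {α} {β} eq with compare α β
    ... | tri< α<β _ _ = contradiction (mono α<β) (irrefl eq)
    ... | tri≈ _ α≡β _ = α≡β
    ... | tri> _ _ β<α = contradiction (mono β<α) (irrefl (sym eq))

    mono⇒reflects-< : ∀ {α β} → h α < h β → α < β
    mono⇒reflects-< {α} {β} hα<hβ with compare α β
    ... | tri< α<β _ _ = α<β
    ... | tri≈ _ refl _ = contradiction hα<hβ (irrefl refl)
    ... | tri> _ _ β<α = contradiction hα<hβ (asym (mono β<α))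

  -- κ embeds in {0, 1} if no α has two predecessors.
  two-predecessors : ∃[ α ] ∃[ β ] ∃[ γ ] β < γ × γ < α
  two-predecessors = dne λ none → unc (embedding none)
    where
    embedding : ¬ (∃[ α ] ∃[ β ] ∃[ γ ] β < γ × γ < α) → K ↣ ℕ
    embedding none = mk↣ {to = rank} rank-injective
      where
      rank : K → ℕ
      rank α with lem {∃[ β ] β < α}
      ... | yes _ = 1
      ... | no _  = 0

      -- If α < β, equal ranks give α a predecessor too, and then β has two.
      rank-≮ : ∀ α β → rank α ≡ rank β → ¬ (α < β)
      rank-≮ α β eq α<β with lem {∃[ γ ] γ < α} | lem {∃[ γ ] γ < β}
      ... | yes (γ , γ<α) | _      = none (β , γ , α , γ<α , α<β)
      ... | no _          | no ¬p  = ¬p (α , α<β)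
      rank-≮ α β () _ | no _ | yes _

      rank-injective : ∀ {α β} → rank α ≡ rank β → α ≡ β
      rank-injective {α} {β} eq =
        dne λ α≢β → rank-≮ β α (sym eq) (<-≢⇒> (rank-≮ α β eq) α≢β)

  -- Coding of sequences and pairs; regularity of κ

  encode : Seq< κ K ↣ K
  encode = ↔⇒↣ (↔-sym stable)

  open Injection encode using () renaming (to to code; injective to code-injective)

  -- Decidable equality on κ gives uniqueness of identity proofs, so the common length can be
  -- cancelled.
  code-injectiveʳ : ∀ {α} {s t : Seg κ α → K} → code (α , s) ≡ code (α , t) → s ≡ t
  code-injectiveʳ eq =
    ,-injectiveʳ-UIP (Decidable⇒UIP.≡-irrelevant _≟_) (code-injective eq)

  private
    α₂ = proj₁ two-predecessors
    α₀ = proj₁ (proj₂ two-predecessors)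
    α₁ = proj₁ (proj₂ (proj₂ two-predecessors))
    α₀<α₁ = proj₁ (proj₂ (proj₂ (proj₂ two-predecessors)))
    α₁<α₂ = proj₂ (proj₂ (proj₂ (proj₂ two-predecessors)))

  α₀≢α₁ : α₀ ≢ α₁
  α₀≢α₁ eq = irrefl eq α₀<α₁

  pair : K → K → Seg κ α₂ → K
  pair a b v with value v ≟ α₀
  ... | yes _ = a
  ... | no _  = b

  pair-α₀ : ∀ a b p → pair a b (α₀ , p) ≡ a
  pair-α₀ a b p with α₀ ≟ α₀
  ... | yes _ = refl
  ... | no ≢  = contradiction refl ≢

  pair-α₁ : ∀ a b p → pair a b (α₁ , p) ≡ b
  pair-α₁ a b p with α₁ ≟ α₀
  ... | yes eq = contradiction (sym eq) α₀≢α₁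
  ... | no _   = refl

  -- A pair is a sequence of length `α₂`, read off at `α₀` and `α₁`.
  ⟨_,_⟩ : K → K → K
  ⟨ a , b ⟩ = code (α₂ , pair a b)

  ⟨,⟩-injective : ∀ {a b c d} → ⟨ a , b ⟩ ≡ ⟨ c , d ⟩ → a ≡ c × b ≡ d
  ⟨,⟩-injective {a} {b} {c} {d} eq =
    at pair-α₀ [ <-trans α₀<α₁ α₁<α₂ ] , at pair-α₁ [ α₁<α₂ ]
    where
    at : ∀ {α} {π : K → K → K} → (∀ a b p → pair a b (α , p) ≡ π a b) →
         ∀ p → π a b ≡ π c d
    at π-eq p = trans (sym (π-eq a b p))
      (trans (cong (λ s → s (_ , p)) (code-injectiveʳ eq)) (π-eq c d p))

  -- The ranges of ⟨ α₀ , _ ⟩ and ⟨ α₁ , _ ⟩ are disjoint, so a maximum would be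
  -- missed by one of them, which would then inject κ into a proper segment.
  no-maximum : ∀ α → ∃[ β ] α < β
  no-maximum α = dne λ max →
    missed α₀ max λ _ eq₀ → missed α₁ max λ _ eq₁ →
      α₀≢α₁ (proj₁ (⟨,⟩-injective (trans eq₀ (sym eq₁))))
    where
    missed : ∀ a → ¬ (∃[ β ] α < β) → ¬ (∀ b → ⟨ a , b ⟩ ≢ α)
    missed a max miss = initial α (mk↣ {to = λ b →
      ⟨ a , b ⟩ , [ <-≢⇒> (λ lt → max (_ , lt)) (λ eq → miss b (sym eq)) ]}
      (λ eq → proj₂ (⟨,⟩-injective (cong value eq))))

  common-upper-bound : ∀ α β → ∃[ γ ] α < γ × β < γ
  common-upper-bound α β with compare α β
  ... | tri< α<β _ _ =
    let γ , β<γ = no-maximum β in γ , <-trans α<β β<γ , β<γ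
  ... | tri≈ _ refl _ = let γ , α<γ = no-maximum α in γ , α<γ , α<γ
  ... | tri> _ _ β<α =
    let γ , α<γ = no-maximum α in γ , α<γ , <-trans β<α α<γ

  -- If f were cofinal, choose s(β) outside { t(β) ∣ code t ≤ f(β) }, which is
  -- smaller than κ. The code of s lies below some f(β), a contradiction.
  regular : ∀ {α} (f : Seg κ α → K) → ∃[ γ ] (∀ β → f β < γ)
  regular {α} f = dne λ cofinal →
    let diagonal : ∀ β → ∃[ y ] ¬ Hit β y
        diagonal β = ¬∀⇒∃¬ (hit-not-all β)
        s = proj₁ ∘ diagonal
        β , fβ≮ = ¬∀⇒∃¬ (λ bounded → cofinal (code (α , s) , bounded))
    in proj₂ (diagonal β) (_ , fβ≮ , s , refl , refl)
    where
    Hit : Seg κ α → K → Set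
    Hit β y = ∃[ ξ ] ¬ (f β < ξ) × Σ[ s ∈ (Seg κ α → K) ] code (α , s) ≡ ξ × s β ≡ y

    -- Distinct y need distinct codes ξ ≤ f β, so otherwise κ would inject into a proper segment.
    hit-not-all : ∀ β → ¬ (∀ y → Hit β y)
    hit-not-all β hit =
      let δ , fβ<δ = no-maximum (f β) in
      initial δ (mk↣ {to = λ y → proj₁ (hit y) , [ below fβ<δ (proj₁ (proj₂ (hit y))) ]}
        (λ eq → decode (proj₂ (proj₂ (hit _))) (proj₂ (proj₂ (hit _))) (cong value eq)))
      where
      below : ∀ {δ ξ} → f β < δ → ¬ (f β < ξ) → ξ < δ
      below {δ} {ξ} fβ<δ fβ≮ξ with compare ξ δ
      ... | tri< ξ<δ _ _ = ξ<δ
      ... | tri≈ _ refl _ = contradiction fβ<δ fβ≮ξ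
      ... | tri> _ _ δ<ξ = contradiction (<-trans fβ<δ δ<ξ) fβ≮ξ

      decode : ∀ {ξ ζ x y} →
               Σ[ s ∈ (Seg κ α → K) ] code (α , s) ≡ ξ × s β ≡ x →
               Σ[ s ∈ (Seg κ α → K) ] code (α , s) ≡ ζ × s β ≡ y →
               ξ ≡ ζ → x ≡ y
      decode (s , refl , refl) (t , eq , refl) refl =
        cong (λ u → u β) (code-injectiveʳ (sym eq))

  -- Inverting the injection lists J along α, and regularity bounds the list.
  Size<⇒bounded : {J : Subset K} → Size< κ J → ∃[ γ ] (∀ {j} → j ∈ J → j < γ)
  Size<⇒bounded {J} (α , size) =
    let γ , below = regular preimage in γ , λ {j} p →
      subst (_< γ) (preimage-to (j , [ p ])) (below (to (j , [ p ])))
    where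
    open Injection size using (to; injective)

    preimage : Seg κ α → K
    preimage β with lem {∃[ r ] to r ≡ β}
    ... | yes (r , _) = value r
    -- An arbitrary default off the range of `to`.
    ... | no _        = α

    preimage-to : ∀ r → preimage (to r) ≡ value r
    preimage-to r with lem {∃[ r′ ] to r′ ≡ to r}
    ... | yes (_ , eq) = cong value (injective eq)
    ... | no ¬hit      = contradiction (r , refl) ¬hit

  -- The unfolding equation requires a step that respects pointwise equality, whence extensionality.
  recursion : (step : ∀ ξ → (Seg κ ξ → K) → K) →
              Σ[ h ∈ (K → K) ] (∀ ξ → h ξ ≡ step ξ (h ∘ value))
  recursion step = All.wfRec wellFounded 0ℓ (λ _ → K) step′ , λ _ → unfold-wfRec
    where
    step′ : ∀ ξ → (∀ {η} → η < ξ → K) → K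
    step′ ξ f = step ξ (λ v → f (holds v))

    open FixPoint wellFounded (λ _ → K) step′
      (λ ξ eq → cong (step ξ) (ext (eq ∘ holds)))
      using (unfold-wfRec)

  -- κ-compact and closed sets

  -- For x outside A, the sets of all y with y(α) ≠ x(α) cover A. A small subcover uses only α below
  -- some γ, so no point of A agrees with x below γ.
  compact⇒closed : ∀ {A} → Compact κ A → Closed κ A
  compact⇒closed {A} compact x x∉A =
    let J , small , cover = compact K differs differs-open A⊆differs
        γ , below = Size<⇒bounded small
    in (γ , x ∘ value) , (λ _ → refl) , λ y∈cone y∈A →
      let j , j∈J , yj≢xj = cover y∈A in yj≢xj (y∈cone (j , [ below j∈J ]))
    where
    differs : K → Subset (Baire κ)
    differs α y = y α ≢ x α

    differs-open : ∀ α → Open κ (differs α)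
    differs-open α y yα≢xα =
      let γ , α<γ = no-maximum α in
      (γ , y ∘ value) , (λ _ → refl) ,
      λ z∈cone zα≡xα → yα≢xα (trans (sym (z∈cone (α , [ α<γ ]))) zα≡xα)

    A⊆differs : A ⊆ ⋃ K differs
    A⊆differs y∈A = ¬∀⇒∃¬ λ y≗x → x∉A (subst A (ext y≗x) y∈A)

  -- The complement of C, indexed by `nothing`, extends a cover of C to one of A. It contains no
  -- point of C, so the subcover can drop it.
  closed⊆compact⇒compact : ∀ {A C} → Compact κ A → Closed κ C → C ⊆ A → Compact κ C
  closed⊆compact⇒compact {A} {C} compact closed C⊆A I U U-open C⊆U =
    let J , (α , size) , cover = compact (Maybe I) U⁺ U⁺-open A⊆U⁺
    in J ∘ just
     , (α , size ↣-∘ mk↣ {to = λ { (i , p) → just i , p }}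
              (λ eq → value-injective (just-injective (cong value eq))))
     , λ x∈C → restrict x∈C (cover (C⊆A x∈C))
    where
    U⁺ : Maybe I → Subset (Baire κ)
    U⁺ = maybe U (∁ C)

    U⁺-open : ∀ i → Open κ (U⁺ i)
    U⁺-open (just i) = U-open i
    U⁺-open nothing  = closed

    A⊆U⁺ : A ⊆ ⋃ (Maybe I) U⁺
    A⊆U⁺ {x} _ with lem {C x}
    ... | yes x∈C = let i , x∈Ui = C⊆U x∈C in just i , x∈Ui
    ... | no x∉C  = nothing , x∉C

    restrict : ∀ {x} {J : Subset (Maybe I)} → x ∈ C →
               ∃[ i ] i ∈ J × x ∈ U⁺ i → ∃[ i ] just i ∈ J × x ∈ U i
    restrict x∈C (just i , i∈J , x∈Ui) = i , i∈J , x∈Ui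
    restrict x∈C (nothing , _ , x∉C)   = contradiction x∈C x∉C

  -- κ-compactness of ^κ2

  -- `Compact` speaks of subsets of ^κκ only, so the notion is restated for the whole of ^κ2.
  CantorCompact : Set₁
  CantorCompact = (I : Set) (U : I → Subset (Fun κ Bool)) →
    (∀ i → bounded κ Bool (U i)) → (∀ x → ∃[ i ] x ∈ U i) →
    Σ[ J ∈ Subset I ] Size< κ J × (∀ x → ∃[ i ] i ∈ J × x ∈ U i)

  -- A cover of ^κ2 pulls back to the traces on C of open sets `W i` of ^κκ, and these cover C.
  compact≅cantor : ∀ {C} → Compact κ C →
    Homeomorphic (subspace (bounded κ K) C) (bounded κ Bool) → CantorCompact
  compact≅cantor {C} compact (f , to-continuous , _) I U U-open covers =
    let J , small , cover = compact I W W-open C⊆W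
    in J , small , λ x →
      let i , i∈J , ∈W = cover (holds (from x))
      in i , i∈J , subst (U i) (strictlyInverseˡ x) (proj₂ (W-pullback i) ∈W)
    where
    open Inverse f using (to; from; strictlyInverseˡ)

    W : I → Subset (Baire κ)
    W i = proj₁ (to-continuous (U i) (U-open i))

    W-open : ∀ i → Open κ (W i)
    W-open i = proj₁ (proj₂ (to-continuous (U i) (U-open i)))

    W-pullback = λ i → proj₂ (proj₂ (to-continuous (U i) (U-open i)))

    C⊆W : C ⊆ ⋃ I W
    C⊆W {x} x∈C = let i , ∈U = covers (to (x , [ x∈C ])) in i , proj₁ (W-pullback i) ∈U

  -- From κ-compactness of ^κ2 to the partition property

  module Partition (c : K → K → Bool) where

    Agree : Fun κ Bool → K → Subset K
    Agree x γ β = ∀ {α} → α < γ → c α β ≡ x α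

    -- The point x is a cofinal branch of the tree of all restrictions of c(·, β) to γ with γ ≤ β.
    branch : CantorCompact → ∃[ x ] (∀ γ → ∃[ β ] ¬ (β < γ) × β ∈ Agree x γ)
    branch compact = dne λ no-branch →
      let covers : ∀ x → ∃[ γ ] x ∈ U γ
          covers x = dne λ uncovered → no-branch (x , λ γ → dne λ none →
            uncovered (γ , λ β agree → dne λ β≮γ → none (β , β≮γ , agree)))
          _ , small , cover = compact K U U-open covers
          γ , below = Size<⇒bounded small
          -- β = γ trivially agrees with this point below γ, so its membership in `U γ` would give γ
          -- < γ.
          _ , j∈J , ∈Uj = cover (λ α → c α γ)
      in irrefl refl (U-mono (below j∈J) ∈Uj γ (λ _ → refl))
      where
      U : K → Subset (Fun κ Bool)
      U γ x = ∀ β → β ∈ Agree x γ → β < γ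

      U-open : ∀ γ → bounded κ Bool (U γ)
      U-open γ x x∈U = (γ , x ∘ value) , (λ _ → refl) ,
        λ y∈cone β agree → x∈U β λ α<γ → trans (agree α<γ) (y∈cone (_ , [ α<γ ]))

      U-mono : ∀ {γ δ x} → γ < δ → x ∈ U γ → x ∈ U δ
      U-mono γ<δ x∈U β agree = <-trans (x∈U β λ α<γ → agree (<-trans α<γ γ<δ)) γ<δ

    -- If `true` fails at δ, every witness at a level above δ has colour `false`; and a witness at a
    -- level above γ also serves γ.
    monochromatic-branch : CantorCompact →
      ∃[ x ] ∃[ i ] (∀ γ → ∃[ β ] ¬ (β < γ) × β ∈ Agree x γ × x β ≡ i)
    monochromatic-branch compact =
      let x , unbounded = branch compact in x , colour x unbounded
      where
      colour : ∀ x → (∀ γ → ∃[ β ] ¬ (β < γ) × β ∈ Agree x γ) →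
               ∃[ i ] (∀ γ → ∃[ β ] ¬ (β < γ) × β ∈ Agree x γ × x β ≡ i)
      colour x unbounded
        with lem {∀ γ → ∃[ β ] ¬ (β < γ) × β ∈ Agree x γ × x β ≡ true}
      ... | yes p = true , p
      ... | no ¬p =
        let δ , none = ¬∀⇒∃¬ ¬p in
        false , λ γ →
          let ε , γ<ε , δ<ε = common-upper-bound γ δ
              β , β≮ε , agree = unbounded ε
          in β , (λ β<γ → β≮ε (<-trans β<γ γ<ε))
               , (λ α<γ → agree (<-trans α<γ γ<ε))
               , ¬-not λ xβ≡true → none
                   (β , (λ β<δ → β≮ε (<-trans β<δ δ<ε))
                      , (λ α<δ → agree (<-trans α<δ δ<ε)) , xβ≡true)

    -- By regularity h ξ can be a witness at a level `sup ξ` above all earlier values. Then h η <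
    -- `sup ξ` ≤ h ξ for η < ξ, and agreement gives c(h η, h ξ) = x(h η) = i.
    end-homogeneous : ∀ {x i} →
      (∀ γ → ∃[ β ] ¬ (β < γ) × β ∈ Agree x γ × x β ≡ i) →
      Σ[ h ∈ (K → K) ] (∀ {η ξ} → η < ξ → h η < h ξ × c (h η) (h ξ) ≡ i)
    end-homogeneous {x} {i} unbounded = h , λ {η} {ξ} η<ξ →
      let h≮sup , agree , _ = h-spec ξ
          _ , _ , xh≡i      = h-spec η
      in <-≮-trans (h<sup η<ξ) h≮sup , trans (agree (h<sup η<ξ)) xh≡i
      where
      step : ∀ ξ → (Seg κ ξ → K) → K
      step ξ f = proj₁ (unbounded (proj₁ (regular f)))

      h : K → K
      h = proj₁ (recursion step)

      sup : K → K
      sup ξ = proj₁ (regular {ξ} (h ∘ value))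

      h<sup : ∀ {η ξ} → η < ξ → h η < sup ξ
      h<sup {η} {ξ} η<ξ = proj₂ (regular {ξ} (h ∘ value)) (η , [ η<ξ ])

      h-spec : ∀ ξ → ¬ (h ξ < sup ξ) × h ξ ∈ Agree x (sup ξ) × x (h ξ) ≡ i
      h-spec ξ = subst (λ β → ¬ (β < sup ξ) × β ∈ Agree x (sup ξ) × x β ≡ i)
        (sym (proj₂ (recursion step) ξ)) (proj₂ (unbounded (sup ξ)))

    -- As h is strictly increasing, it is injective and every increasing pair in its range comes
    -- from an increasing pair of arguments.
    homogeneous-range : ∀ {h : K → K} {i} →
      (∀ {η ξ} → η < ξ → h η < h ξ × c (h η) (h ξ) ≡ i) →
      Σ[ H ∈ Subset K ] Size≡ κ H ×
        (∃[ i ] (∀ {α β} → α ∈ H → β ∈ H → α < β → c α β ≡ i))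
    homogeneous-range {h} {i} spec =
      H , H-size , i , λ { (_ , refl) (_ , refl) hη<hξ →
        proj₂ (spec (mono⇒reflects-< (proj₁ ∘ spec) hη<hξ)) }
      where
      H : Subset K
      H α = ∃[ ξ ] h ξ ≡ α

      H-size : Size≡ κ H
      H-size = mk↔ₛ′ (λ v → proj₁ (holds v)) (λ ξ → h ξ , [ ξ , refl ])
        (λ ξ → mono⇒injective (proj₁ ∘ spec)
                 (proj₂ (holds {P = H} (h ξ , [ ξ , refl ]))))
        (λ v → value-injective (proj₂ (holds v)))

  cantorCompact⇒weaklyCompact : CantorCompact → WeaklyCompact κ
  cantorCompact⇒weaklyCompact compact = unc , λ c →
    let open Partition c
        _ , _ , unbounded = monochromatic-branch compact
        _ , spec          = end-homogeneous unbounded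
    in homogeneous-range spec

  -- Sizes of κ-compact and Kκ sets

  compact⇒size≤ : ¬ WeaklyCompact κ →
    ((C : Subset (Baire κ)) → Closed κ C → PerfectSetProperty κ C) →
    ∀ {A} → Compact κ A → Size≤ κ A
  compact⇒size≤ ¬wc psp {A} compact = [ (λ size → size) , large ]′
    (psp A (compact⇒closed compact))
    where
    large : Σ[ C ∈ Subset (Baire κ) ] C ⊆ A × Closed κ C ×
              Homeomorphic (subspace (bounded κ K) C) (bounded κ Bool) → Size≤ κ A
    large (C , C⊆A , closed , homeo) = contradiction
      (cantorCompact⇒weaklyCompact
        (compact≅cantor (closed⊆compact⇒compact compact closed C⊆A) homeo))
      ¬wc

  -- Each x in A is coded by the pair of a chosen index i and its code within `C i`.
  ⋃-size≤ : {X I : Set} {C : I → Subset X} {A : Subset X} → I ↣ K →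
            (∀ i → Size≤ κ (C i)) → A ⊆ ⋃ I C → Size≤ κ A
  ⋃-size≤ {X} {I} {C} {A} I↣K size A⊆⋃ = mk↣ {to = to} λ {v} {w} eq →
    let index-eq , element-eq = ⟨,⟩-injective eq in
    value-injective (determined (Injection.injective I↣K index-eq) element-eq)
    where
    index : Refinement X A → I
    index v = proj₁ (A⊆⋃ (holds v))

    element : (v : Refinement X A) → Refinement X (C (index v))
    element v = value v , [ proj₂ (A⊆⋃ (holds v)) ]

    to : Refinement X A → K
    to v = ⟨ Injection.to I↣K (index v) , Injection.to (size (index v)) (element v) ⟩

    -- Codes within `C i` and `C j` are comparable only once i and j are identified.
    determined : ∀ {i j} {r : Refinement X (C i)} {s : Refinement X (C j)} → i ≡ j →
                 Injection.to (size i) r ≡ Injection.to (size j) s → value r ≡ value s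
    determined {i} refl eq = cong value (Injection.injective (size i) eq)

  singleton-compact : ∀ a → Compact κ (_≡ a)
  singleton-compact a I U U-open a∈⋃U =
    let i , a∈Ui = a∈⋃U refl in
    (_≡ i) ,
    -- The segment of `α₁` contains `α₀`, which is room enough for one index.
    (α₁ , mk↣ {to = λ _ → α₀ , [ α₀<α₁ ]}
            (λ {v} {w} _ → value-injective (trans (holds v) (sym (holds w))))) ,
    λ { refl → i , refl , a∈Ui }

  size≤⇒Kκ : ∀ {A} → Size≤ κ A → IsKκ κ A
  size≤⇒Kκ {A} size =
    -- The singletons are indexed by A itself, so `size` bounds their number.
    Refinement (Baire κ) A , (λ v → _≡ value v) , size , singleton-compact ∘ value ,
    (λ x∈A → (_ , [ x∈A ]) , refl) , λ { (v , refl) → holds v }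

corollary2p8 : ExcludedMiddle (suc 0ℓ) → Extensionality 0ℓ 0ℓ →
    (κ : Cardinal) → Uncountable κ → PowerStable κ →
    ¬ WeaklyCompact κ →
    ((C : Subset (Baire κ)) → Closed κ C → PerfectSetProperty κ C) →
    (A : Subset (Baire κ)) →
    (IsKκ κ A ⇔ (Σ[ B ∈ Subset (Baire κ) ] IsKκ κ B × A ⊆ B)) ×
    ((Σ[ B ∈ Subset (Baire κ) ] IsKκ κ B × A ⊆ B) ⇔ Size≤ κ A)
corollary2p8 em ext κ unc stable ¬wc psp A =
  -- Both equivalences come from the cycle (a) to (b) to (c) to (a).
  mk⇔ contained (size≤⇒Kκ ∘ small) , mk⇔ small (contained ∘ size≤⇒Kκ)
  where
  open Stable em ext κ unc stable

  contained : IsKκ κ A → Σ[ B ∈ Subset (Baire κ) ] IsKκ κ B × A ⊆ B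
  contained A-Kκ = A , A-Kκ , λ x∈A → x∈A

  small : (Σ[ B ∈ Subset (Baire κ) ] IsKκ κ B × A ⊆ B) → Size≤ κ A
  small (B , (I , C , I↣K , compact , B⊆⋃ , _) , A⊆B) =
    ⋃-size≤ I↣K (λ i → compact⇒size≤ ¬wc psp (compact i)) (B⊆⋃ ∘ A⊆B)
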